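{- Every minor of a graphic flag matroid is graphic.
   Context: A flag matroid is a pair $(E,\mathcal{F})$ where $E$ is finite and $\mathcal{F}$ is a family of subsets of $E$ (feasible sets) such that, if $j_1<\dots<j_k$ are the cardinalities of members of $\mathcal{F}$, then for each $i$ the sets of size $j_i$ in $\mathcal{F}$ are the bases of a matroid $M_i$ on $E$, and each $M_{i+1}$ is a nontrivial lift of $M_i$ (every flat of $M_i$ is a flat of $M_{i+1}$, and $M_{i+1}\neq M_i$); $(M_1,\dots,M_k)$ is its sequential representation. For $\mathfrak{F}=(E,\mathcal{F})$ and $e\in E$: the deletion is $\mathfrak{F}\setminus e=(E\setminus\{e\},\{F\in\mathcal{F}: e\notin F\})$; the dual is $\mathfrak{F}^*=(E,\{E\setminus F: F\in\mathcal{F}\})$; the contraction is $\mathfrak{F}/e=(\mathfrak{F}^*\setminus e)^*$; the $i$th chopping $C_{ -i}(\mathfrak{F})$ is $(E,\{F\in\mathcal{F}: |F|\neq i\})$. A minor of $\mathfrak{F}$ is a flag matroid obtained from $\mathfrak{F}$ by a sequence of deletions, contractions and choppings. Graphs may have loops and multiple edges. For partitions, $\mathcal{P}\succ\mathcal{Q}$ means $\mathcal{Q}$ is finer than $\mathcal{P}$. For a graph $G=(V,E)$ and a partition $\mathcal{P}$ of $V$, let $e^{\mathcal{P}}$ be the edge joining the cells containing the endpoints of $e$; $M(G,\mathcal{P})$ is the matroid on $E$ in which $S$ is independent iff the multigraph on the cells of $\mathcal{P}$ with edges $\{e^{\mathcal{P}}:e\in S\}$ has no cycles (loops count as cycles).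 A flag matroid is graphic if there exist a graph $G=(V,E)$ and a chain of partitions $\mathcal{P}_1\succ\dots\succ\mathcal{P}_k$ of $V$ such that its sequential representation is $(M(G,\mathcal{P}_1),\dots,M(G,\mathcal{P}_k))$. -}

module Defs where

open import Data.Nat using (ℕ; zero; suc; _<_; _%_)
open import Data.Nat.DivMod using (m%n<n)
open import Data.Bool using (Bool; true; false)
open import Data.Fin using (Fin; toℕ; fromℕ<)
open import Data.Fin.Subset using (Subset; _∈_; _∉_; _⊆_; _∪_; _∩_; _-_; ⁅_⁆; ∁; ∣_∣)
open import Data.Vec using (insertAt)
open import Data.Product using (Σ; ∃; ∃-syntax; _×_; _,_)
open import Data.Sum using (_⊎_)
open import Relation.Nullary using (¬_)
open import Relation.Binary.PropositionalEquality using (_≡_)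
open import Function.Definitions using (Injective)
open import Function.Bundles using (_⇔_)

-- Ground set E = Fin n.  A family of subsets of E is a Bool-valued
-- predicate on subsets (the feasible sets are those mapped to true).

Fam : ℕ → Set
Fam n = Subset n → Bool

IsMatroidBases : ∀ {n} → (Subset n → Set) → Set
IsMatroidBases {n} Bs =
  (∃[ B ] Bs B) ×
  (∀ B₁ B₂ → Bs B₁ → Bs B₂ → ∀ x → x ∈ B₁ → x ∉ B₂ →
     ∃[ y ] (y ∈ B₂ × y ∉ B₁ × Bs ((B₁ - x) ∪ ⁅ y ⁆)))

-- r(X) < r(Y), where r(Z) = max over bases B of |B ∩ Z|.
RankLt : ∀ {n} → (Subset n → Set) → Subset n → Subset n → Set
RankLt Bs X Y = ∃[ B ] (Bs B × (∀ B' → Bs B' → ∣ B' ∩ X ∣ < ∣ B ∩ Y ∣))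

IsFlat : ∀ {n} → (Subset n → Set) → Subset n → Set
IsFlat Bs X = ∀ e → e ∉ X → RankLt Bs X (X ∪ ⁅ e ⁆)

IsLift : ∀ {n} → (Subset n → Set) → (Subset n → Set) → Set
IsLift {n} Bs Bs' = ∀ (X : Subset n) → IsFlat Bs X → IsFlat Bs' X

SameBases : ∀ {n} → (Subset n → Set) → (Subset n → Set) → Set
SameBases {n} Bs Bs' = ∀ (S : Subset n) → Bs S ⇔ Bs' S

Level : ∀ {n} → Fam n → ℕ → Subset n → Set
Level F j S = (F S ≡ true) × (∣ S ∣ ≡ j)

Occurs : ∀ {n} → Fam n → ℕ → Set
Occurs F j = ∃[ S ] Level F j S

IsFlagMatroid : ∀ {n} → Fam n → Set
IsFlagMatroid F =
  (∀ j → Occurs F j → IsMatroidBases (Level F j)) ×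
  (∀ j j' → j < j' → Occurs F j → Occurs F j' →
     (∀ l → j < l → l < j' → ¬ Occurs F l) →
     IsLift (Level F j) (Level F j') × ¬ SameBases (Level F j) (Level F j'))

delete : ∀ {n} → Fam (suc n) → Fin (suc n) → Fam n
delete F e S = F (insertAt S e false)

dual : ∀ {n} → Fam n → Fam n
dual F S = F (∁ S)

contract : ∀ {n} → Fam (suc n) → Fin (suc n) → Fam n
contract F e = dual (delete (dual F) e)

chop : ∀ {n} → ℕ → Fam n → Fam n
chop i F S with ∣ S ∣ Data.Nat.≟ i
... | Relation.Nullary.yes _ = false
... | Relation.Nullary.no _ = F S

data Minor {n} (F : Fam n) : ∀ {m} → Fam m → Set where
  here : Minor F F
  del  : ∀ {m} {G : Fam (suc m)} → Minor F G → (e : Fin (suc m)) →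
         IsFlagMatroid (delete G e) → Minor F (delete G e)
  con  : ∀ {m} {G : Fam (suc m)} → Minor F G → (e : Fin (suc m)) →
         IsFlagMatroid (contract G e) → Minor F (contract G e)
  chp  : ∀ {m} {G : Fam m} → Minor F G → (i : ℕ) →
         IsFlagMatroid (chop i G) → Minor F (chop i G)

-- Graphic matroids M(G, P).
-- A graph with vertex set Fin v and edge set Fin n is given by
-- ends : Fin n → Fin v × Fin v (loops and parallel edges allowed).
-- A partition of the vertex set is given by a labelling p : Fin v → ℕ;
-- its cells are the nonempty fibres of p (cell of u is labelled p u).

csuc : ∀ {k} → Fin (suc k) → Fin (suc k)
csuc {k} j = fromℕ< (m%n<n (suc (toℕ j)) (suc k))

Joins : ∀ {v n} → (Fin n → Fin v × Fin v) → (Fin v → ℕ) → Fin n → ℕ → ℕ → Set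
Joins ends p e a b with ends e
... | (u , w) = ((p u ≡ a) × (p w ≡ b)) ⊎ ((p u ≡ b) × (p w ≡ a))

-- the multigraph on the cells of P with edges {e^P : e ∈ S} has a cycle
-- (a loop is a cycle of length 1; k+1 distinct edges through k+1 distinct cells)
HasCycle : ∀ {v n} → (Fin n → Fin v × Fin v) → (Fin v → ℕ) → Subset n → Set
HasCycle {v} {n} ends p S =
  ∃[ k ] ∃[ es ] ∃[ cs ]
    (Injective {A = Fin (suc k)} {B = Fin n} _≡_ _≡_ es ×
     Injective {A = Fin (suc k)} {B = ℕ} _≡_ _≡_ cs ×
     (∀ j → es j ∈ S) ×
     (∀ j → Joins ends p (es j) (cs j) (cs (csuc j))))

GIndep : ∀ {v n} → (Fin n → Fin v × Fin v) → (Fin v → ℕ) → Subset n → Set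
GIndep ends p S = ¬ HasCycle ends p S

GBasis : ∀ {v n} → (Fin n → Fin v × Fin v) → (Fin v → ℕ) → Subset n → Set
GBasis ends p S = GIndep ends p S × (∀ T → S ⊆ T → GIndep ends p T → T ≡ S)

-- Q is finer than P  (P ≻ Q)
Finer : ∀ {v} → (Fin v → ℕ) → (Fin v → ℕ) → Set
Finer P Q = ∀ u w → Q u ≡ Q w → P u ≡ P w

IsGraphic : ∀ {n} → Fam n → Set
IsGraphic {n} F =
  IsFlagMatroid F ×
  ∃[ v ] ∃[ ends ] ∃[ k ] Σ (Fin k → (Fin v → ℕ)) λ Ps →
    (∀ (i j : Fin k) → toℕ j ≡ suc (toℕ i) → Finer (Ps i) (Ps j)) ×
    (∀ (i j : Fin k) → toℕ j ≡ suc (toℕ i) →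
       ∀ B B' → GBasis {v} {n} ends (Ps i) B → GBasis ends (Ps j) B' → ∣ B ∣ < ∣ B' ∣) ×
    (∀ S → (F S ≡ true) ⇔ (∃[ i ] GBasis ends (Ps i) S))

{-# OPTIONS --safe #-}
module Submission where

-- M(G, P) depends only on the cells containing the ends of each edge, and a set
-- is independent iff no edge of it has its ends connected by the remaining
-- edges.  Level by level, deleting e from the graph gives the bases avoiding e
-- unless e is a coloop of M(G, Pᵢ), and deleting e after merging the cells of
-- its two ends in Pᵢ gives the bases containing e unless e is a loop; in the
-- exceptional case level i contributes nothing to the minor and Pᵢ is dropped.
-- Chopping drops the level of the given rank.  Dropping levels preserves the
-- chain condition and the strict increase of the ranks, since every M(G, P)
-- has a basis and its bases are equicardinal by Steinitz exchange.

open import Defs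
open import Data.Nat using (ℕ; zero; suc; _≤_; _<_; _≟_; _≤?_; z≤n; s≤s; s<s⁻¹; _%_)
open import Data.Nat.DivMod using (m<n⇒m%n≡m; n%n≡0)
open import Data.Nat.Properties using (≤-antisym; ≤-trans; ≤-reflexive; <-trans; <-irrefl)
open import Data.Bool using (true; false; not)
open import Data.Bool.Properties using (not-involutive)
open import Data.Fin using (Fin; zero; suc; toℕ; fromℕ; inject₁; punchIn; punchOut)
open import Data.Fin.Properties using (any?; toℕ-injective; toℕ-inject₁; toℕ-fromℕ; toℕ-fromℕ<; toℕ<n; fromℕ≢inject₁; inject₁-injective; punchIn-injective; punchInᵢ≢i; punchIn-punchOut)
open import Data.Fin.Relation.Unary.Top using (view; ‵fromℕ; ‵inject₁)
open import Data.Fin.Subset using (Subset; _∈_; _∉_; _⊆_; _∪_; ⁅_⁆; ∁; ∣_∣)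
open import Data.Fin.Subset.Properties using (_∈?_; x∈⁅x⁆; x∈⁅y⁆⇒x≡y; p⊆p∪q; q⊆p∪q; x∈p∪q⁻)
open import Data.List using (List; []; _∷_; length)
import Data.Fin as Fin
import Data.List as List
open import Data.List.Properties using (length-map)
open import Data.List.Relation.Unary.Any using (Any; here; there)
open import Data.List.Relation.Unary.Any.Properties using (map⁺)
import Data.List.Relation.Unary.Any as Any
open import Data.Vec using ([]; _∷_; insertAt; removeAt; lookup)
open import Data.Vec.Properties using ([]=⇒lookup; lookup⇒[]=; insertAt-lookup; insertAt-punchIn; insertAt-removeAt; removeAt-insertAt; map-insertAt; map-∘; map-cong; map-id)
import Data.Vec as Vec
open import Data.Product using (Σ; ∃-syntax; _×_; _,_; proj₁; proj₂)
import Data.Product as Product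
open import Data.Sum using (_⊎_; inj₁; inj₂)
import Data.Sum as Sum
open import Data.Unit using (⊤; tt)
open import Function using (_∘_; case_of_)
open import Function.Bundles using (_⇔_; mk⇔; module Equivalence)
open import Function.Definitions using (Injective)
open import Relation.Binary.Construct.Closure.ReflexiveTransitive using (Star; ε; _◅_; _◅◅_; kleisliStar; return; reverse)
import Relation.Binary.Construct.Closure.ReflexiveTransitive as Star
open import Relation.Binary.PropositionalEquality using (_≡_; _≢_; refl; sym; trans; cong; subst; subst₂)
open import Relation.Nullary using (¬_; Dec; yes; no; contradiction)
open import Relation.Nullary.Decidable using (decidable-stable; ¬?; _×-dec_)
import Relation.Nullary.Decidable as Dec

open Equivalence using (to; from)

-- Labelled edges, connectivity and independence

Pairs : ℕ × ℕ → ℕ → ℕ → Set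
Pairs (c , d) a b = (c ≡ a × d ≡ b) ⊎ (c ≡ b × d ≡ a)

Pairs-sym : ∀ x {a b} → Pairs x a b → Pairs x b a
Pairs-sym _ = Sum.swap

Pairs-map : ∀ (m : ℕ → ℕ) x {a b} → Pairs x a b → Pairs (Product.map m m x) (m a) (m b)
Pairs-map m _ = Sum.map (Product.map (cong m) (cong m)) (Product.map (cong m) (cong m))

Pairs-unique : ∀ x {a b c d} → Pairs x a b → Pairs x c d → (a ≡ c × b ≡ d) ⊎ (a ≡ d × b ≡ c)
Pairs-unique _ (inj₁ (refl , refl)) q = q
Pairs-unique _ (inj₂ (refl , refl)) (inj₁ (refl , refl)) = inj₂ (refl , refl)
Pairs-unique _ (inj₂ (refl , refl)) (inj₂ (refl , refl)) = inj₁ (refl , refl)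

-- Encodes (G, P) by the cells containing the two ends of each edge.
Labels : ℕ → Set
Labels n = Fin n → ℕ × ℕ

labels : ∀ {v n} → (Fin n → Fin v × Fin v) → (Fin v → ℕ) → Labels n
labels ends p e = Product.map p p (ends e)

Link : ∀ {n} → Labels n → (Fin n → Set) → ℕ → ℕ → Set
Link l P a b = ∃[ e ] (P e × Pairs (l e) a b)

Conn : ∀ {n} → Labels n → (Fin n → Set) → ℕ → ℕ → Set
Conn l P = Star (Link l P)

Conn-sym : ∀ {n} (l : Labels n) {P a b} → Conn l P a b → Conn l P b a
Conn-sym l = reverse λ { (e , pe , j) → e , pe , Pairs-sym (l e) j }

Conn-mono : ∀ {n} {l : Labels n} {P Q : Fin n → Set} {a b} → (∀ {e} → P e → Q e) →
            Conn l P a b → Conn l Q a b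
Conn-mono h = Star.map λ { (e , pe , j) → e , h pe , j }

Without : ∀ {n} → Subset n → Fin n → Fin n → Set
Without S e f = f ∈ S × f ≢ e

-- Arbitrary walks stand in for cycles, so no distinctness of edges or vertices has to be maintained
-- when edges are contracted.
Indep : ∀ {n} → Labels n → Subset n → Set
Indep l S = ∀ e {a b} → e ∈ S → Pairs (l e) a b → ¬ Conn l (Without S e) a b

-- Independence in terms of cycles

record SimplePath {n} (l : Labels n) (P : Fin n → Set) (k : ℕ) (a b : ℕ) : Set where
  field
    verts     : Fin (suc k) → ℕ
    edges     : Fin k → Fin n
    verts-inj : Injective _≡_ _≡_ verts
    start     : verts zero ≡ a
    end       : verts (fromℕ k) ≡ b
    edges-in  : ∀ i → P (edges i)
    joins     : ∀ i → Pairs (l (edges i)) (verts (inject₁ i)) (verts (suc i))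

  -- Follows from distinctness of the vertices: an edge determines its two ends, so equal edges sit
  -- at equal positions, or else at two positions each of which is the successor of the other.
  edges-inj : Injective _≡_ _≡_ edges
  edges-inj {i} {j} eq
    with Pairs-unique (l (edges j)) (subst (λ e → Pairs (l e) (verts (inject₁ i)) (verts (suc i))) eq (joins i)) (joins j)
  ... | inj₁ (p , _) = inject₁-injective (verts-inj p)
  ... | inj₂ (p , q) = contradiction
    (sym (trans i≡1+j (cong suc j≡1+i))) 2+n≢n
    where
    i≡1+j : toℕ i ≡ suc (toℕ j)
    i≡1+j = trans (sym (toℕ-inject₁ i)) (cong toℕ (verts-inj p))
    j≡1+i : toℕ j ≡ suc (toℕ i)
    j≡1+i = trans (sym (toℕ-inject₁ j)) (cong toℕ (sym (verts-inj q)))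
    2+n≢n : ∀ {n} → suc (suc n) ≢ n
    2+n≢n ()

open SimplePath

module _ {n} {l : Labels n} {P : Fin n → Set} where

  tail : ∀ {k a b} (π : SimplePath l P (suc k) a b) → SimplePath l P k (verts π (suc zero)) b
  tail π = record
    { verts = verts π ∘ suc ; edges = edges π ∘ suc
    ; verts-inj = λ eq → case verts-inj π eq of λ { refl → refl }
    ; start = refl ; end = end π
    ; edges-in = edges-in π ∘ suc ; joins = joins π ∘ suc }

  suffix : ∀ {k a b} (π : SimplePath l P k a b) i → ∃[ j ] SimplePath l P j (verts π i) b
  suffix {k} π zero = k , record
    { verts = verts π ; edges = edges π ; verts-inj = verts-inj π
    ; start = refl ; end = end π ; edges-in = edges-in π ; joins = joins π }
  suffix {suc k} π (suc i) = suffix (tail π) i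

  cons : ∀ {k a b c} (π : SimplePath l P k b c) e → P e → Pairs (l e) a b →
         (∀ i → verts π i ≢ a) → SimplePath l P (suc k) a c
  cons {a = a} π e pe j fresh = record
    { verts = λ { zero → a ; (suc i) → verts π i }
    ; edges = λ { zero → e ; (suc i) → edges π i }
    ; verts-inj = λ { {zero} {zero} _ → refl
                    ; {zero} {suc y} eq → contradiction (sym eq) (fresh y)
                    ; {suc x} {zero} eq → contradiction eq (fresh x)
                    ; {suc x} {suc y} eq → cong suc (verts-inj π eq) }
    ; start = refl ; end = end π
    ; edges-in = λ { zero → pe ; (suc i) → edges-in π i }
    ; joins = λ { zero → subst (Pairs (l e) a) (sym (start π)) j ; (suc i) → joins π i } }

  -- The path is built from its far end. A new first vertex that already occurs on the path cuts it
  -- back to that occurrence.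
  loop-erasure : ∀ {a b} → Conn l P a b → ∃[ k ] SimplePath l P k a b
  loop-erasure {a} ε = zero , record
    { verts = λ _ → a ; edges = λ () ; verts-inj = λ { {zero} {zero} _ → refl }
    ; start = refl ; end = refl ; edges-in = λ () ; joins = λ () }
  loop-erasure {a} ((e , pe , j) ◅ r) with loop-erasure r
  ... | k , π with any? (λ i → verts π i ≟ a)
  ...   | yes (i , refl) = suffix π i
  ...   | no none = suc k , cons π e pe j (λ i eq → none (i , eq))

  walk : ∀ k (f : Fin (suc k) → ℕ) → (∀ i → Link l P (f (inject₁ i)) (f (suc i))) →
         Conn l P (f zero) (f (fromℕ k))
  walk zero f h = ε
  walk (suc k) f h = h zero ◅ walk k (f ∘ suc) (h ∘ suc)

  path⇒Conn : ∀ {k a b} → SimplePath l P k a b → Conn l P a b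
  path⇒Conn {k} π = subst₂ (Conn l P) (start π) (end π)
    (walk k (verts π) (λ i → edges π i , edges-in π i , joins π i))

restrict : ∀ {n} {l : Labels n} {P Q : Fin n → Set} {k a b} (π : SimplePath l P k a b) →
           (∀ i → Q (edges π i)) → SimplePath l Q k a b
restrict π h = record
  { verts = verts π ; edges = edges π ; verts-inj = verts-inj π
  ; start = start π ; end = end π ; edges-in = h ; joins = joins π }

csuc-inject₁ : ∀ {k} (i : Fin k) → csuc (inject₁ i) ≡ suc i
csuc-inject₁ {k} i = toℕ-injective (trans (toℕ-fromℕ< _)
  (trans (cong (λ x → suc x % suc k) (toℕ-inject₁ i)) (m<n⇒m%n≡m (s≤s (toℕ<n i)))))

csuc-fromℕ : ∀ k → csuc (fromℕ k) ≡ zero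
csuc-fromℕ k = toℕ-injective (trans (toℕ-fromℕ< _)
  (trans (cong (λ x → suc x % suc k) (toℕ-fromℕ k)) (n%n≡0 (suc k))))

module _ {A : Set} where

  -- Places the closing edge of a cycle at the last index, where `csuc` wraps round to `zero`.
  snoc : ∀ {k} → (Fin k → A) → A → Fin (suc k) → A
  snoc {zero} f x _ = x
  snoc {suc k} f x zero = f zero
  snoc {suc k} f x (suc i) = snoc (f ∘ suc) x i

  snoc-inject₁ : ∀ {k} (f : Fin k → A) x i → snoc f x (inject₁ i) ≡ f i
  snoc-inject₁ f x zero = refl
  snoc-inject₁ f x (suc i) = snoc-inject₁ (f ∘ suc) x i

  snoc-fromℕ : ∀ {k} (f : Fin k → A) x → snoc f x (fromℕ k) ≡ x
  snoc-fromℕ {zero} f x = refl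
  snoc-fromℕ {suc k} f x = snoc-fromℕ (f ∘ suc) x

  snoc-injective : ∀ {k} (f : Fin k → A) x → Injective _≡_ _≡_ f → (∀ i → f i ≢ x) →
                   Injective _≡_ _≡_ (snoc f x)
  snoc-injective f x f-inj f≢x {i} {j} eq with view i | view j
  ... | ‵fromℕ | ‵fromℕ = refl
  ... | ‵fromℕ | ‵inject₁ j₀ = contradiction
    (trans (sym (snoc-inject₁ f x j₀)) (trans (sym eq) (snoc-fromℕ f x))) (f≢x j₀)
  ... | ‵inject₁ i₀ | ‵fromℕ = contradiction
    (trans (sym (snoc-inject₁ f x i₀)) (trans eq (snoc-fromℕ f x))) (f≢x i₀)
  ... | ‵inject₁ i₀ | ‵inject₁ j₀ = cong inject₁
    (f-inj (trans (sym (snoc-inject₁ f x i₀)) (trans eq (snoc-inject₁ f x j₀))))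

module _ {v n} (ends : Fin n → Fin v × Fin v) (p : Fin v → ℕ) where

  private l = labels ends p

  -- The simple path extracted from the walk is closed up by `e`, which it avoids. For a loop the
  -- path is empty and the cycle has length 1.
  Conn⇒HasCycle : ∀ {S e a b} → e ∈ S → Pairs (l e) a b → Conn l (Without S e) a b →
                  HasCycle ends p S
  Conn⇒HasCycle {S} {e} {a} {b} e∈S je r with loop-erasure r
  ... | k , π = k , es , verts π ,
      snoc-injective (edges π) e (edges-inj π) (proj₂ ∘ edges-in π) , verts-inj π ,
      member , joined
    where
    es = snoc (edges π) e
    member : ∀ j → es j ∈ S
    member j with view j
    ... | ‵fromℕ = subst (_∈ S) (sym (snoc-fromℕ (edges π) e)) e∈S
    ... | ‵inject₁ i = subst (_∈ S) (sym (snoc-inject₁ (edges π) e i)) (proj₁ (edges-in π i))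
    joined : ∀ j → Pairs (l (es j)) (verts π j) (verts π (csuc j))
    joined j with view j
    -- The closing edge is traversed backwards, from `b` to `a`.
    ... | ‵fromℕ rewrite snoc-fromℕ (edges π) e | csuc-fromℕ k | start π | end π =
      Pairs-sym (l e) je
    ... | ‵inject₁ i rewrite snoc-inject₁ (edges π) e i | csuc-inject₁ i = joins π i

  GIndep⇒Indep : ∀ {S} → GIndep ends p S → Indep l S
  GIndep⇒Indep acyclic e e∈S je r = acyclic (Conn⇒HasCycle e∈S je r)

  -- The ends of the last edge of a cycle are joined by the walk through the other edges, all
  -- different from it by injectivity of `es`.
  Indep⇒GIndep : ∀ {S} → Indep l S → GIndep ends p S
  Indep⇒GIndep {S} ind (k , es , cs , es-inj , _ , member , joined) =
    ind (es (fromℕ k)) (member (fromℕ k))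
      (Pairs-sym (l (es (fromℕ k)))
        (subst (Pairs (l (es (fromℕ k))) _) (cong cs (csuc-fromℕ k)) (joined (fromℕ k))))
      (walk k cs λ i → es (inject₁ i) ,
        (member (inject₁ i) , λ eq → fromℕ≢inject₁ (sym (es-inj eq))) ,
        subst (Pairs (l (es (inject₁ i))) _) (cong cs (csuc-inject₁ i)) (joined (inject₁ i)))

-- Deletion and contraction

e∈insertAt : ∀ {n} (S : Subset n) e → e ∈ insertAt S e true
e∈insertAt S e = lookup⇒[]= e _ (insertAt-lookup S e true)

e∉insertAt : ∀ {n} (S : Subset n) e → e ∉ insertAt S e false
e∉insertAt S e e∈ with () ← trans (sym ([]=⇒lookup e∈)) (insertAt-lookup S e false)

punchIn∈⁺ : ∀ {n} {S : Subset n} e b {g} → g ∈ S → punchIn e g ∈ insertAt S e b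
punchIn∈⁺ {S = S} e b {g} g∈S = lookup⇒[]= _ _ (trans (insertAt-punchIn S e b g) ([]=⇒lookup g∈S))

punchIn∈⁻ : ∀ {n} {S : Subset n} e b {g} → punchIn e g ∈ insertAt S e b → g ∈ S
punchIn∈⁻ {S = S} e b {g} g∈ = lookup⇒[]= _ _ (trans (sym (insertAt-punchIn S e b g)) ([]=⇒lookup g∈))

data PunchIn {n} (e : Fin (suc n)) : Fin (suc n) → Set where
  hole    : PunchIn e e
  punched : ∀ g → PunchIn e (punchIn e g)

punchIn? : ∀ {n} (e f : Fin (suc n)) → PunchIn e f
punchIn? e f with e Fin.≟ f
... | yes refl = hole
... | no e≢f = subst (PunchIn e) (punchIn-punchOut e≢f) (punched (punchOut e≢f))

insertAt-⊆ : ∀ {n} {S T : Subset n} e b → S ⊆ T → insertAt S e b ⊆ insertAt T e b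
insertAt-⊆ {S = S} {T} e b S⊆T {f} f∈ with punchIn? e f
... | hole = lookup⇒[]= e _ (trans (insertAt-lookup T e b) (trans (sym (insertAt-lookup S e b)) ([]=⇒lookup f∈)))
... | punched g = punchIn∈⁺ e b (S⊆T (punchIn∈⁻ e b f∈))

insertAt-⊆-true : ∀ {n} {S T : Subset n} e b → S ⊆ T → insertAt S e b ⊆ insertAt T e true
insertAt-⊆-true {S = S} {T} e b S⊆T {f} f∈ with punchIn? e f
... | hole = e∈insertAt T e
... | punched g = punchIn∈⁺ e true (S⊆T (punchIn∈⁻ e b f∈))

insertAt-⊆⁻ : ∀ {n} {S T : Subset n} e b c → insertAt S e b ⊆ insertAt T e c → S ⊆ T
insertAt-⊆⁻ e b c ⊆ = punchIn∈⁻ e c ∘ ⊆ ∘ punchIn∈⁺ e b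

data InsertAt {n} (e : Fin (suc n)) : Subset (suc n) → Set where
  inserted : ∀ S b → InsertAt e (insertAt S e b)

insertAt? : ∀ {n} (e : Fin (suc n)) S → InsertAt e S
insertAt? e S = subst (InsertAt e) (insertAt-removeAt S e) (inserted (removeAt S e) (lookup S e))

∣insertAt-false∣ : ∀ {n} (S : Subset n) e → ∣ insertAt S e false ∣ ≡ ∣ S ∣
∣insertAt-false∣ S zero = refl
∣insertAt-false∣ (false ∷ S) (suc e) = ∣insertAt-false∣ S e
∣insertAt-false∣ (true ∷ S) (suc e) = cong suc (∣insertAt-false∣ S e)

∣insertAt-true∣ : ∀ {n} (S : Subset n) e → ∣ insertAt S e true ∣ ≡ suc ∣ S ∣
∣insertAt-true∣ S zero = refl
∣insertAt-true∣ (false ∷ S) (suc e) = ∣insertAt-true∣ S e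
∣insertAt-true∣ (true ∷ S) (suc e) = cong suc (∣insertAt-true∣ S e)

Indep-⊆ : ∀ {n} {l : Labels n} {S T} → S ⊆ T → Indep l T → Indep l S
Indep-⊆ S⊆T ind e e∈S j r = ind e (S⊆T e∈S) j (Conn-mono (Product.map₁ S⊆T) r)

module _ {n} (l : Labels (suc n)) (e : Fin (suc n)) where

  Indep-delete : ∀ S → Indep (l ∘ punchIn e) S ⇔ Indep l (insertAt S e false)
  Indep-delete S = mk⇔ extend shrink
    where
    extend : Indep (l ∘ punchIn e) S → Indep l (insertAt S e false)
    extend ind f f∈ j r with punchIn? e f
    ... | hole = e∉insertAt S e f∈
    ... | punched g = ind g (punchIn∈⁻ e false f∈) j (Star.map step r)
      where
      step : ∀ {a b} → Link l (Without (insertAt S e false) (punchIn e g)) a b →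
             Link (l ∘ punchIn e) (Without S g) a b
      step (h , (h∈ , h≢) , j) with punchIn? e h
      ... | hole = contradiction h∈ (e∉insertAt S e)
      ... | punched h₀ = h₀ , (punchIn∈⁻ e false h∈ , h≢ ∘ cong (punchIn e)) , j
    shrink : Indep l (insertAt S e false) → Indep (l ∘ punchIn e) S
    shrink ind g g∈ j r = ind (punchIn e g) (punchIn∈⁺ e false g∈) j
      (Star.map (λ { (h , (h∈ , h≢) , j) →
         punchIn e h , (punchIn∈⁺ e false h∈ , h≢ ∘ punchIn-injective e h g) , j }) r)

  loop⇒¬Indep : ∀ {S} → proj₁ (l e) ≡ proj₂ (l e) → e ∈ S → ¬ Indep l S
  loop⇒¬Indep loop e∈S ind = ind e e∈S (inj₁ (refl , sym loop)) ε

-- Identification of the two ends of an edge, carried out on labels; the second label survives.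
merge : ℕ × ℕ → ℕ → ℕ
merge (a , b) x with x ≟ a
... | yes _ = b
... | no _ = x

merge-left : ∀ a b → merge (a , b) a ≡ b
merge-left a b with a ≟ a
... | yes _ = refl
... | no a≢a = contradiction refl a≢a

merge-right : ∀ a b → merge (a , b) b ≡ b
merge-right a b with b ≟ a
... | yes _ = refl
... | no _ = refl

merge-ends : ∀ x {a b} → Pairs x a b → merge x a ≡ merge x b
merge-ends (c , d) (inj₁ (refl , refl)) = trans (merge-left c d) (sym (merge-right c d))
merge-ends (c , d) (inj₂ (refl , refl)) = trans (merge-right c d) (sym (merge-left c d))

merge-cases : ∀ a b x → merge (a , b) x ≡ x ⊎ (x ≡ a × merge (a , b) x ≡ b)
merge-cases a b x with x ≟ a
... | yes x≡a = inj₂ (x≡a , refl)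
... | no _ = inj₁ refl

contractLabels : ∀ {n} → Labels (suc n) → Fin (suc n) → Labels n
contractLabels l e f = Product.map (merge (l e)) (merge (l e)) (l (punchIn e f))

-- The edge is the first edge of a simple path.
first-edge : ∀ {n} {l : Labels n} {P a b} → a ≢ b → Conn l P a b →
             ∃[ g ] ∃[ c ] (P g × Pairs (l g) a c × Conn l (λ f → P f × f ≢ g) c b)
first-edge a≢b r with loop-erasure r
... | zero , π = contradiction (trans (sym (start π)) (end π)) a≢b
... | suc k , π = edges π zero , verts π (suc zero) , edges-in π zero ,
      subst (λ x → Pairs _ x _) (start π) (joins π zero) ,
      path⇒Conn (restrict (tail π) λ i →
        edges-in π (suc i) , λ eq → case edges-inj π eq of λ ())

module _ {n} (l : Labels (suc n)) (e : Fin (suc n)) where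

  private
    l/e = contractLabels l e
    m = merge (l e)

  -- Walks project to the contraction, steps along `e` collapsing, and lift back by inserting `e`
  -- where the identified vertices must be joined. For a loop `e` the right side always fails,
  -- whereas the left holds for the empty set.
  Indep-contract : proj₁ (l e) ≢ proj₂ (l e) → ∀ S →
                   Indep l/e S ⇔ Indep l (insertAt S e true)
  Indep-contract nonloop S = mk⇔ extend shrink
    where
    S+e = insertAt S e true
    step : ∀ {P Q a b} → (∀ h → P (punchIn e h) → Q h) →
           Link l P a b → Conn l/e Q (m a) (m b)
    step P⇒Q (h , ph , j) with punchIn? e h
    ... | hole = subst (Conn l/e _ _) (merge-ends (l e) j) ε
    ... | punched h₀ = return (h₀ , P⇒Q h₀ ph , Pairs-map m (l h) j)
    nonloop′ : ∀ {a b} → Pairs (l e) a b → a ≢ b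
    nonloop′ (inj₁ (refl , refl)) = nonloop
    nonloop′ (inj₂ (refl , refl)) = nonloop ∘ sym
    extend : Indep l/e S → Indep l S+e
    extend ind f f∈ j r with punchIn? e f
    ... | punched g = ind g (punchIn∈⁻ e true f∈) (Pairs-map m (l f) j)
      (kleisliStar m (step λ h → λ (h∈ , h≢) → punchIn∈⁻ e true h∈ , h≢ ∘ cong (punchIn e)) r)
    -- A walk joining the ends of `e` without `e` becomes closed after contraction. Its first edge
    -- `g` then has its ends joined by the rest, which avoids `g`.
    ... | hole with first-edge (nonloop′ j) r
    ...   | g , c , (g∈ , g≢e) , jg , r′ with punchIn? e g
    ...     | hole = contradiction refl g≢e
    ...     | punched g₀ = ind g₀ (punchIn∈⁻ e true g∈) (Pairs-map m (l g) (Pairs-sym (l g) jg))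
      (subst (Conn l/e _ _) (sym (merge-ends (l e) j))
        (kleisliStar m (step λ h → λ ((h∈ , _) , h≢) →
          punchIn∈⁻ e true h∈ , h≢ ∘ cong (punchIn e)) r′))
    shrink : Indep l S+e → Indep l/e S
    shrink ind g g∈ j r = ind (punchIn e g) (punchIn∈⁺ e true g∈) (inj₁ (refl , refl))
      (lift-ends j (Star.concat (Star.map lift r)))
      where
      P = Without S+e (punchIn e g)
      -- At most the edge `e` is used here; it is available because it differs from `punchIn e g`.
      toMerged : ∀ x → Conn l P x (m x)
      toMerged x with merge-cases (proj₁ (l e)) (proj₂ (l e)) x
      ... | inj₁ eq = subst (Conn l P x) (sym eq) ε
      ... | inj₂ (x≡a , eq) = return (e , (e∈insertAt S e , punchInᵢ≢i e g ∘ sym) ,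
        inj₁ (sym x≡a , sym eq))
      lift-ends : ∀ {a b c d} → Pairs (m c , m d) a b → Conn l P a b → Conn l P c d
      lift-ends {c = c} {d} (inj₁ (refl , refl)) r = toMerged c ◅◅ r ◅◅ Conn-sym l (toMerged d)
      lift-ends {c = c} {d} (inj₂ (refl , refl)) r =
        toMerged c ◅◅ Conn-sym l r ◅◅ Conn-sym l (toMerged d)
      lift : ∀ {a b} → Link l/e (Without S g) a b → Conn l P a b
      lift (h , (h∈ , h≢) , j) with l (punchIn e h) in eq | j
      ... | c , d | inj₁ (refl , refl) = Conn-sym l (toMerged c) ◅◅
        (punchIn e h , (punchIn∈⁺ e true h∈ , h≢ ∘ punchIn-injective e h g) ,
          subst (λ x → Pairs x c d) (sym eq) (inj₁ (refl , refl))) ◅ toMerged d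
      ... | c , d | inj₂ (refl , refl) = Conn-sym l (toMerged d) ◅◅
        (punchIn e h , (punchIn∈⁺ e true h∈ , h≢ ∘ punchIn-injective e h g) ,
          subst (λ x → Pairs x d c) (sym eq) (inj₂ (refl , refl))) ◅ toMerged c

-- Bases

-- One crossing of the extra pair is always enough: of two crossings in the same direction only the
-- later is kept, and two opposite ones cancel.
split-Star : ∀ {R : ℕ → ℕ → Set} {c d a b} → Star (λ x y → Pairs (c , d) x y ⊎ R x y) a b →
             Star R a b ⊎ (Star R a c × Star R d b) ⊎ (Star R a d × Star R c b)
split-Star ε = inj₁ ε
split-Star (inj₂ s ◅ r) =
  Sum.map (s ◅_) (Sum.map (Product.map₁ (s ◅_)) (Product.map₁ (s ◅_))) (split-Star r)
split-Star (inj₁ (inj₁ (refl , refl)) ◅ r) with split-Star r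
... | inj₁ q = inj₂ (inj₁ (ε , q))
... | inj₂ (inj₁ (_ , q)) = inj₂ (inj₁ (ε , q))
... | inj₂ (inj₂ (_ , q)) = inj₁ q
split-Star (inj₁ (inj₂ (refl , refl)) ◅ r) with split-Star r
... | inj₁ q = inj₂ (inj₂ (ε , q))
... | inj₂ (inj₁ (_ , q)) = inj₁ q
... | inj₂ (inj₂ (_ , q)) = inj₂ (inj₂ (ε , q))

-- Edges form a bare list of label pairs because the exchange argument relabels and drops them
-- freely and counts only the length.
ListLink : List (ℕ × ℕ) → ℕ → ℕ → Set
ListLink X a b = Any (λ x → Pairs x a b) X

ListConn : List (ℕ × ℕ) → ℕ → ℕ → Set
ListConn X = Star (ListLink X)

ListConn-sym : ∀ {X a b} → ListConn X a b → ListConn X b a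
ListConn-sym = reverse (Any.map λ {x} → Pairs-sym x)

ListConn-map : ∀ m {X a b} → ListConn X a b → ListConn (List.map (Product.map m m) X) (m a) (m b)
ListConn-map m = Star.gmap m (map⁺ ∘ Any.map λ {x} → Pairs-map m x)

-- Steinitz exchange: identifying two connected but distinct vertices makes
-- one of the edges redundant.
exchange : ∀ (m : ℕ → ℕ) {a b} → m a ≡ m b → a ≢ b → ∀ X → ListConn X a b →
           ∃[ Y ] (length X ≡ suc (length Y) ×
                   (∀ {c d} → ListConn X c d → ListConn Y (m c) (m d)))
exchange m ma≡mb a≢b [] ε = contradiction refl a≢b
exchange m {a} {b} ma≡mb a≢b ((c , d) ∷ X) r = choose (split-Star (Star.map uncons r))
  where
  uncons : ∀ {x y} → ListLink ((c , d) ∷ X) x y → Pairs (c , d) x y ⊎ ListLink X x y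
  uncons (here j) = inj₁ j
  uncons (there s) = inj₂ s
  mX = List.map (Product.map m m) X
  redundant : ListConn mX (m c) (m d) →
    ∃[ Y ] (length ((c , d) ∷ X) ≡ suc (length Y) ×
            (∀ {x y} → ListConn ((c , d) ∷ X) x y → ListConn Y (m x) (m y)))
  redundant cd = mX , cong suc (sym (length-map _ X)) , kleisliStar m λ
    { (here (inj₁ (refl , refl))) → cd
    ; (here (inj₂ (refl , refl))) → ListConn-sym cd
    ; (there s) → ListConn-map m (return s) }
  choose : ListConn X a b ⊎ (ListConn X a c × ListConn X d b) ⊎ (ListConn X a d × ListConn X c b) →
    ∃[ Y ] (length ((c , d) ∷ X) ≡ suc (length Y) ×
            (∀ {x y} → ListConn ((c , d) ∷ X) x y → ListConn Y (m x) (m y)))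
  -- The connection does without the head, whose image is kept while a redundant edge is sought in
  -- `X`.
  choose (inj₁ ab) with exchange m ma≡mb a≢b X ab
  ... | Y , len , conn = (m c , m d) ∷ Y , cong suc len , kleisliStar m λ
    { (here j) → return (here (Pairs-map m (c , d) j))
    ; (there s) → Star.map there (conn (return s)) }
  -- The connection crosses the head. After merging, the ends of the head are joined through the
  -- common image of `a` and `b`, so the head itself can go.
  choose (inj₂ (inj₁ (ac , db))) = redundant
    (ListConn-map m (ListConn-sym ac) ◅◅ subst (λ x → ListConn mX x (m d)) (sym ma≡mb)
      (ListConn-map m (ListConn-sym db)))
  choose (inj₂ (inj₂ (ad , cb))) = redundant
    (ListConn-map m cb ◅◅ subst (λ x → ListConn mX x (m d)) ma≡mb (ListConn-map m ad))

-- The double negation makes decidability of connectivity unnecessary.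
indep≤spanning : ∀ {n} (l : Labels n) T X → Indep l T →
  (∀ {e} → e ∈ T → ¬ ¬ ListConn X (proj₁ (l e)) (proj₂ (l e))) → ∣ T ∣ ≤ length X
indep≤spanning l [] X ind spans = z≤n
indep≤spanning l (false ∷ T) X ind spans =
  indep≤spanning (l ∘ suc) T X (from (Indep-delete l zero T) ind) (spans ∘ Vec.there)
indep≤spanning l (true ∷ T) X ind spans =
  decidable-stable (_ ≤? _) λ fails → spans Vec.here λ conn → fails (bound conn)
  where
  nonloop : proj₁ (l zero) ≢ proj₂ (l zero)
  nonloop loop = loop⇒¬Indep l zero loop Vec.here ind
  bound : ListConn X (proj₁ (l zero)) (proj₂ (l zero)) → suc ∣ T ∣ ≤ length X
  bound conn with exchange (merge (l zero)) (merge-ends (l zero) (inj₁ (refl , refl))) nonloop X conn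
  -- Contracting the edge `zero` lowers both sides by one: it leaves the independent set, and
  -- merging its ends frees one pair of `X`.
  ... | Y , len , contracts = ≤-trans
    (s≤s (indep≤spanning (contractLabels l zero) T Y (from (Indep-contract l zero nonloop T) ind)
      λ e∈T → λ fails → spans (Vec.there e∈T) (fails ∘ contracts)))
    (≤-reflexive (sym len))

edgeList : ∀ {n} → Labels n → Subset n → List (ℕ × ℕ)
edgeList l [] = []
edgeList l (false ∷ S) = edgeList (l ∘ suc) S
edgeList l (true ∷ S) = l zero ∷ edgeList (l ∘ suc) S

length-edgeList : ∀ {n} (l : Labels n) S → length (edgeList l S) ≡ ∣ S ∣
length-edgeList l [] = refl
length-edgeList l (false ∷ S) = length-edgeList (l ∘ suc) S
length-edgeList l (true ∷ S) = cong suc (length-edgeList (l ∘ suc) S)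

edgeList-Any : ∀ {n} (l : Labels n) S {P : ℕ × ℕ → Set} {e} → e ∈ S → P (l e) → Any P (edgeList l S)
edgeList-Any l (true ∷ S) Vec.here pe = here pe
edgeList-Any l (true ∷ S) (Vec.there e∈S) pe = there (edgeList-Any (l ∘ suc) S e∈S pe)
edgeList-Any l (false ∷ S) (Vec.there e∈S) pe = edgeList-Any (l ∘ suc) S e∈S pe

Basis : ∀ {n} → Labels n → Subset n → Set
Basis l S = Indep l S × (∀ T → S ⊆ T → Indep l T → T ≡ S)

-- A cycle created by adding `e` must run through `e`, and its other edges would then connect the
-- ends of `e` within `S`.
Indep-∪ : ∀ {n} (l : Labels n) {S e} → e ∉ S → Indep l S →
          ¬ Conn l (_∈ S) (proj₁ (l e)) (proj₂ (l e)) → Indep l (S ∪ ⁅ e ⁆)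
Indep-∪ l {S} {e} e∉S ind ¬conn f f∈ j r = connects (x∈p∪q⁻ S ⁅ e ⁆ f∈)
  where
  c = proj₁ (l e)
  d = proj₂ (l e)
  old : ∀ {h} → h ∈ S ∪ ⁅ e ⁆ → h ≢ e → h ∈ S
  old h∈ h≢e with x∈p∪q⁻ S ⁅ e ⁆ h∈
  ... | inj₁ h∈S = h∈S
  ... | inj₂ h∈e = contradiction (x∈⁅y⁆⇒x≡y e h∈e) h≢e
  separate : ∀ {x y} → Link l (Without (S ∪ ⁅ e ⁆) f) x y →
             Pairs (c , d) x y ⊎ Link l (Without S f) x y
  separate (h , (h∈ , h≢f) , j) with h Fin.≟ e
  ... | yes refl = inj₁ j
  ... | no h≢e = inj₂ (h , (old h∈ h≢e , h≢f) , j)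
  e-conn : ∀ {a b} → Pairs (c , d) a b → ¬ Conn l (_∈ S) a b
  e-conn (inj₁ (refl , refl)) = ¬conn
  e-conn (inj₂ (refl , refl)) = ¬conn ∘ Conn-sym l
  connects : f ∈ S ⊎ f ∈ ⁅ e ⁆ → _
  connects (inj₂ f∈e) with refl ← x∈⁅y⁆⇒x≡y e f∈e =
    e-conn j (Conn-mono (λ (h∈ , h≢e) → old h∈ h≢e) r)
  connects (inj₁ f∈S) with split-Star (Star.map separate r)
  ... | inj₁ q = ind f f∈S j q
  ... | inj₂ (inj₁ (ac , db)) = ¬conn (Conn-mono proj₁ (Conn-sym l ac) ◅◅
    (f , f∈S , j) ◅ Conn-mono proj₁ (Conn-sym l db))
  ... | inj₂ (inj₂ (ad , cb)) = ¬conn (Conn-mono proj₁ cb ◅◅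
    (f , f∈S , Pairs-sym (l f) j) ◅ Conn-mono proj₁ ad)

-- An edge with unconnected ends could be added without losing independence, against maximality.
Basis-spans : ∀ {n} (l : Labels n) {S} → Basis l S → ∀ e →
              ¬ ¬ Conn l (_∈ S) (proj₁ (l e)) (proj₂ (l e))
Basis-spans l {S} (ind , maximal) e ¬conn with e ∈? S
... | yes e∈S = ¬conn (return (e , e∈S , inj₁ (refl , refl)))
... | no e∉S = e∉S (subst (e ∈_)
  (maximal (S ∪ ⁅ e ⁆) (p⊆p∪q ⁅ e ⁆) (Indep-∪ l e∉S ind ¬conn))
  (q⊆p∪q S ⁅ e ⁆ (x∈⁅x⁆ e)))

indep≤basis : ∀ {n} (l : Labels n) {S T} → Basis l S → Indep l T → ∣ T ∣ ≤ ∣ S ∣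
indep≤basis l {S} {T} bS ind = ≤-trans
  (indep≤spanning l T (edgeList l S) ind λ {e} _ fails → Basis-spans l bS e
    (fails ∘ Star.map λ (h , h∈S , j) → edgeList-Any l S h∈S j))
  (≤-reflexive (length-edgeList l S))

Basis-equicardinal : ∀ {n} (l : Labels n) {S T} → Basis l S → Basis l T → ∣ S ∣ ≡ ∣ T ∣
Basis-equicardinal l bS bT = ≤-antisym (indep≤basis l bT (proj₁ bS)) (indep≤basis l bS (proj₁ bT))

insertAt-injective : ∀ {n} {S T : Subset n} e b → insertAt S e b ≡ insertAt T e b → S ≡ T
insertAt-injective {S = S} {T} e b eq =
  trans (sym (removeAt-insertAt S e b)) (trans (cong (λ x → removeAt x e) eq) (removeAt-insertAt T e b))

module _ {n} (l : Labels (suc n)) (e : Fin (suc n)) where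

  -- Every superset of a set containing `e` contains `e`, so the two maximality conditions range
  -- over corresponding sets.
  Basis-contract : proj₁ (l e) ≢ proj₂ (l e) → ∀ S →
                   Basis (contractLabels l e) S ⇔ Basis l (insertAt S e true)
  Basis-contract nonloop S = mk⇔ extend shrink
    where
    iff = Indep-contract l e nonloop
    extend : Basis (contractLabels l e) S → Basis l (insertAt S e true)
    extend (ind , maximal) = to (iff S) ind , maximal⁺
      where
      maximal⁺ : ∀ T → insertAt S e true ⊆ T → Indep l T → T ≡ insertAt S e true
      maximal⁺ T S⊆T indT with insertAt? e T
      ... | inserted T₀ false = contradiction (S⊆T (e∈insertAt S e)) (e∉insertAt T₀ e)
      ... | inserted T₀ true = cong (λ x → insertAt x e true)
        (maximal T₀ (insertAt-⊆⁻ e true true S⊆T) (from (iff T₀) indT))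
    shrink : Basis l (insertAt S e true) → Basis (contractLabels l e) S
    shrink (ind , maximal) = from (iff S) ind , λ T S⊆T indT →
      insertAt-injective e true (maximal _ (insertAt-⊆-true e true S⊆T) (to (iff T) indT))

  Basis-delete⁻ : ∀ {S} → Basis l (insertAt S e false) → Basis (l ∘ punchIn e) S
  Basis-delete⁻ {S} (ind , maximal) = from (Indep-delete l e S) ind , λ T S⊆T indT →
    insertAt-injective e false (maximal _ (insertAt-⊆ e false S⊆T) (to (Indep-delete l e T) indT))

  -- A larger independent set that avoids `e` is governed by maximality in the deletion; one that
  -- contains `e` would include `insertAt S e true`, which is dependent.
  Basis-delete⁺ : ∀ {S} → ¬ Indep l (insertAt S e true) → Basis (l ∘ punchIn e) S →
                  Basis l (insertAt S e false)
  Basis-delete⁺ {S} dep (ind , maximal) = to (Indep-delete l e S) ind , maximal⁺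
    where
    maximal⁺ : ∀ T → insertAt S e false ⊆ T → Indep l T → T ≡ insertAt S e false
    maximal⁺ T S⊆T indT with insertAt? e T
    ... | inserted T₀ true = contradiction
      (Indep-⊆ {l = l} (insertAt-⊆-true e true (insertAt-⊆⁻ e false true S⊆T)) indT) dep
    ... | inserted T₀ false = cong (λ x → insertAt x e false)
      (maximal T₀ (insertAt-⊆⁻ e false false S⊆T) (from (Indep-delete l e T₀) indT))

-- Eliminating the edges one by one, through deletion and contraction, avoids any search for walks.
Indep? : ∀ {n} (l : Labels n) S → Dec (Indep l S)
Indep? l [] = yes λ ()
Indep? l (false ∷ S) = Dec.map (Indep-delete l zero S) (Indep? (l ∘ suc) S)
Indep? l (true ∷ S) with proj₁ (l zero) ≟ proj₂ (l zero)
... | yes loop = no (loop⇒¬Indep l zero loop Vec.here)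
... | no nonloop = Dec.map (Indep-contract l zero nonloop S) (Indep? (contractLabels l zero) S)

-- Greedy choice: each edge in turn is taken and contracted unless it has become a loop.
∃Basis : ∀ {n} (l : Labels n) → ∃[ S ] Basis l S
∃Basis {zero} l = [] , (λ ()) , λ { [] _ _ → refl }
∃Basis {suc n} l with proj₁ (l zero) ≟ proj₂ (l zero)
... | yes loop = let S , bS = ∃Basis (l ∘ suc) in
  false ∷ S , Basis-delete⁺ l zero (loop⇒¬Indep l zero loop Vec.here) bS
... | no nonloop = let S , bS = ∃Basis (contractLabels l zero) in
  true ∷ S , to (Basis-contract l zero nonloop S) bS

-- Deletion of an edge that is not a coloop

module _ {n} (l : Labels (suc n)) (e : Fin (suc n)) where

  NonColoop : Set
  NonColoop = ∃[ B ] Basis l (insertAt B e false)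

  -- By counting: `S` and `B` are both bases of the deletion, hence of equal size, so `S` with `e`
  -- added would be larger than the basis `B`.
  NonColoop⇒dependent : NonColoop → ∀ {S} → Basis (l ∘ punchIn e) S →
                        ¬ Indep l (insertAt S e true)
  NonColoop⇒dependent (B , bB) {S} bS ind =
    <-irrefl (Basis-equicardinal (l ∘ punchIn e) bS (Basis-delete⁻ l e bB))
      (subst₂ _≤_ (∣insertAt-true∣ S e) (∣insertAt-false∣ B e) (indep≤basis l bB ind))

  Basis-delete : NonColoop → ∀ S → Basis (l ∘ punchIn e) S ⇔ Basis l (insertAt S e false)
  Basis-delete nc S =
    mk⇔ (λ bS → Basis-delete⁺ l e (NonColoop⇒dependent nc bS) bS) (Basis-delete⁻ l e)

  -- A single basis of the deletion decides: `e` is a coloop exactly when adding it there keeps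
  -- independence.
  NonColoop? : Dec NonColoop
  NonColoop? with ∃Basis (l ∘ punchIn e)
  ... | S , bS with Indep? l (insertAt S e true)
  ...   | no dep = yes (S , Basis-delete⁺ l e dep bS)
  ...   | yes ind = no λ nc → NonColoop⇒dependent nc bS ind

-- Minors of graphic flag matroids

Basis⇔GBasis : ∀ {v n} (ends : Fin n → Fin v × Fin v) p S →
               Basis (labels ends p) S ⇔ GBasis ends p S
Basis⇔GBasis ends p S = mk⇔
  (Product.map (Indep⇒GIndep ends p) λ h T S⊆T → h T S⊆T ∘ GIndep⇒Indep ends p)
  (Product.map (GIndep⇒Indep ends p) λ h T S⊆T → h T S⊆T ∘ Indep⇒GIndep ends p)

-- Graphic representations compare neighbouring levels only, while dropping levels makes distant
-- ones neighbours.
consecutive⇒all : ∀ {k} (R : Fin k → Fin k → Set) → (∀ {i j h} → R i j → R j h → R i h) →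
                  (∀ i j → toℕ j ≡ suc (toℕ i) → R i j) → ∀ i j → toℕ i < toℕ j → R i j
consecutive⇒all R R-trans R-step zero (suc zero) _ = R-step zero (suc zero) refl
consecutive⇒all {suc k} R R-trans R-step zero (suc (suc j)) _ =
  R-trans (R-step zero (suc zero) refl)
    (consecutive⇒all (λ i j → R (suc i) (suc j)) R-trans
      (λ i j eq → R-step (suc i) (suc j) (cong suc eq)) zero (suc j) (s≤s z≤n))
consecutive⇒all {suc k} R R-trans R-step (suc i) (suc j) (s≤s i<j) =
  consecutive⇒all (λ i j → R (suc i) (suc j)) R-trans
    (λ i j eq → R-step (suc i) (suc j) (cong suc eq)) i j i<j

-- Renumbers the surviving levels in their original order.
filterFin : ∀ k {Q : Fin k → Set} → (∀ i → Dec (Q i)) →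
  ∃[ k′ ] Σ (Fin k′ → Fin k) λ f →
    (∀ i j → toℕ i < toℕ j → toℕ (f i) < toℕ (f j)) ×
    (∀ i → Q (f i)) × (∀ j → Q j → ∃[ i ] f i ≡ j)
filterFin zero Q? = zero , (λ ()) , (λ ()) , (λ ()) , λ ()
filterFin (suc k) Q? with filterFin k (Q? ∘ suc) | Q? zero
... | k′ , f , mono , sound , complete | no ¬q₀ =
  k′ , suc ∘ f , (λ i j i<j → s≤s (mono i j i<j)) , sound ,
  λ { zero q → contradiction q ¬q₀ ; (suc j) q → Product.map₂ (cong suc) (complete j q) }
... | k′ , f , mono , sound , complete | yes q₀ =
  suc k′ , (λ { zero → zero ; (suc i) → suc (f i) }) ,
  (λ { zero (suc j) _ → s≤s z≤n ; (suc i) (suc j) (s≤s i<j) → s≤s (mono i j i<j) }) ,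
  (λ { zero → q₀ ; (suc i) → sound i }) ,
  λ { zero _ → zero , refl ; (suc j) q → Product.map suc (cong suc) (complete j q) }

Larger : ∀ {n} → Labels n → Labels n → Set
Larger l l′ = ∀ {B B′} → Basis l B → Basis l′ B′ → ∣ B ∣ < ∣ B′ ∣

-- An actual basis of `l′` is required in the middle; if there were none, both assumptions would
-- hold vacuously.
Larger-trans : ∀ {n} {l l′ l″ : Labels n} → Larger l l′ → Larger l′ l″ → Larger l l″
Larger-trans {l′ = l′} p q bB bB″ = <-trans (p bB (proj₂ (∃Basis l′))) (q (proj₂ (∃Basis l′)) bB″)

-- Working form of a graphic representation: levels are marked by `Kept` rather than removed, and
-- are compared for all pairs, so a minor operation needs no renumbering until `Chain⇒IsGraphic`.
record Chain {n} (F : Fam n) : Set₁ where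
  field
    {v}     : ℕ
    ends    : Fin n → Fin v × Fin v
    {k}     : ℕ
    Ps      : Fin k → Fin v → ℕ
    Kept    : Fin k → Set
    Kept?   : ∀ i → Dec (Kept i)
    finer   : ∀ i j → toℕ i < toℕ j → Finer (Ps i) (Ps j)
    larger  : ∀ {i j} → toℕ i < toℕ j → Kept i → Kept j →
              Larger (labels ends (Ps i)) (labels ends (Ps j))
    feasible : ∀ S → F S ≡ true ⇔ (∃[ i ] (Kept i × Basis (labels ends (Ps i)) S))

Chain⇒IsGraphic : ∀ {n} {F : Fam n} → IsFlagMatroid F → Chain F → IsGraphic F
Chain⇒IsGraphic {n} {F} flag ch with filterFin (Chain.k ch) (Chain.Kept? ch)
... | k′ , f , mono , sound , complete =
  flag , v , ends , k′ , Ps ∘ f ,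
  (λ i j eq → finer (f i) (f j) (mono i j (≤-reflexive (sym eq)))) ,
  (λ i j eq B B′ gB gB′ → larger (mono i j (≤-reflexive (sym eq))) (sound i) (sound j)
    (from (Basis⇔GBasis ends (Ps (f i)) B) gB) (from (Basis⇔GBasis ends (Ps (f j)) B′) gB′)) ,
  λ S → mk⇔ (toLevel S ∘ to (feasible S))
    (λ (i , gS) → from (feasible S) (f i , sound i , from (Basis⇔GBasis ends (Ps (f i)) S) gS))
  where
  open Chain ch
  toLevel : ∀ S → ∃[ i ] (Kept i × Basis (labels ends (Ps i)) S) → ∃[ i ] GBasis ends (Ps (f i)) S
  toLevel S (j , q , bS) with complete j q
  ... | i , refl = i , to (Basis⇔GBasis ends (Ps (f i)) S) bS

module _ {n} {F : Fam n} where

  IsGraphic⇒Chain : IsGraphic F → Chain F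
  IsGraphic⇒Chain (_ , v , ends , k , Ps , finer , larger , feasible) = record
    { ends = ends ; Ps = Ps ; Kept = λ _ → ⊤ ; Kept? = λ _ → yes tt
    ; finer = consecutive⇒all (λ i j → Finer (Ps i) (Ps j))
        (λ p q u w → p u w ∘ q u w) finer
    ; larger = λ {i} {j} i<j _ _ →
        consecutive⇒all (λ i j → Larger (labels ends (Ps i)) (labels ends (Ps j)))
          (λ {i} {j} {h} → Larger-trans {l = labels ends (Ps i)} {labels ends (Ps j)} {labels ends (Ps h)})
          (λ i j eq bB bB′ → larger i j eq _ _
            (to (Basis⇔GBasis ends (Ps i) _) bB) (to (Basis⇔GBasis ends (Ps j) _) bB′))
          i j i<j
    ; feasible = λ S → mk⇔
        (λ FS → let i , gS = to (feasible S) FS in i , tt , from (Basis⇔GBasis ends (Ps i) S) gS)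
        (λ (i , _ , bS) → from (feasible S) (i , to (Basis⇔GBasis ends (Ps i) S) bS)) }

  chop⇔ : ∀ c S → chop c F S ≡ true ⇔ (F S ≡ true × ∣ S ∣ ≢ c)
  chop⇔ c S with ∣ S ∣ ≟ c
  ... | yes eq = mk⇔ (λ ()) (λ (_ , neq) → contradiction eq neq)
  ... | no neq = mk⇔ (_, neq) proj₁

  chop-Chain : ∀ c → Chain F → Chain (chop c F)
  chop-Chain c ch = record
    { ends = ends ; Ps = Ps
    ; Kept = λ i → Kept i × rank i ≢ c
    ; Kept? = λ i → Kept? i ×-dec ¬? (rank i ≟ c)
    ; finer = finer
    ; larger = λ i<j (q , _) (q′ , _) → larger i<j q q′
    ; feasible = λ S → mk⇔
        (λ eq → let FS , neq = to (chop⇔ c S) eq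
                    i , q , bS = to (feasible S) FS
                in i , (q , neq ∘ trans (rank-unique i bS)) , bS)
        (λ (i , (q , neq) , bS) → from (chop⇔ c S)
          (from (feasible S) (i , q , bS) , neq ∘ trans (sym (rank-unique i bS)))) }
    where
    open Chain ch
    -- Any basis serves, since those of one level have equal size; chopping therefore removes a
    -- level entirely or not at all.
    rank : Fin k → ℕ
    rank i = ∣ proj₁ (∃Basis (labels ends (Ps i))) ∣
    rank-unique : ∀ i {S} → Basis (labels ends (Ps i)) S → ∣ S ∣ ≡ rank i
    rank-unique i bS = Basis-equicardinal (labels ends (Ps i)) bS (proj₂ (∃Basis (labels ends (Ps i))))

-- The two complements cancel on the surviving elements and turn the inserted `false` into `true`.
contract-insertAt : ∀ {n} (F : Fam (suc n)) e S → contract F e S ≡ F (insertAt S e true)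
contract-insertAt F e S = cong F (trans (map-insertAt not false (∁ S) e)
  (cong (λ x → insertAt x e true)
    (trans (sym (map-∘ not not S)) (trans (map-cong not-involutive S) (map-id S)))))

mergePartition : ∀ {v} → Fin v × Fin v → (Fin v → ℕ) → Fin v → ℕ
mergePartition (u , w) P x = merge (P u , P w) (P x)

-- A vertex moved by merging in `Q` shares the cell of `u` in `Q`, hence in `P`, so `w` can replace
-- it on both sides. Between such representatives the original refinement applies.
mergePartition-finer : ∀ {v} (uw : Fin v × Fin v) {P Q : Fin v → ℕ} → Finer P Q →
                       Finer (mergePartition uw P) (mergePartition uw Q)
mergePartition-finer (u , w) {P} {Q} finer x y eq =
  let x′ , Qx , Px = representative x
      y′ , Qy , Py = representative y
  in trans Px (trans (cong (merge (P u , P w)) (finer x′ y′ (trans (sym Qx) (trans eq Qy)))) (sym Py))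
  where
  representative : ∀ x → ∃[ x′ ] (mergePartition (u , w) Q x ≡ Q x′ ×
                                  mergePartition (u , w) P x ≡ mergePartition (u , w) P x′)
  representative x with merge-cases (Q u) (Q w) (Q x)
  ... | inj₁ fixed = x , fixed , refl
  ... | inj₂ (Qx≡Qu , moved) = w , moved ,
    trans (cong (merge (P u , P w)) (finer x u Qx≡Qu))
      (merge-ends (P u , P w) (inj₁ (refl , refl)))

module _ {n} {F : Fam (suc n)} (e : Fin (suc n)) (ch : Chain F) where

  open Chain ch

  private
    l : Fin k → Labels (suc n)
    l i = labels ends (Ps i)

  delete-Chain : Chain (delete F e)
  delete-Chain = record
    { ends = ends ∘ punchIn e ; Ps = Ps
    -- If `e` is a coloop, no basis of the level avoids it, yet the graph without `e` still has
    -- bases; keeping the level would add spurious feasible sets.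
    ; Kept = λ i → Kept i × NonColoop (l i) e
    ; Kept? = λ i → Kept? i ×-dec NonColoop? (l i) e
    ; finer = finer
    ; larger = λ {i} {j} i<j (q , nc) (q′ , nc′) {B} {B′} bB bB′ →
        subst₂ _<_ (∣insertAt-false∣ B e) (∣insertAt-false∣ B′ e)
          (larger i<j q q′ (to (Basis-delete (l i) e nc B) bB) (to (Basis-delete (l j) e nc′ B′) bB′))
    ; feasible = λ S → mk⇔
        (λ FS → let i , q , bS = to (feasible (insertAt S e false)) FS
                in i , (q , S , bS) , Basis-delete⁻ (l i) e bS)
        (λ (i , (q , nc) , bS) → from (feasible (insertAt S e false))
          (i , q , to (Basis-delete (l i) e nc S) bS)) }

  contract-Chain : Chain (contract F e)
  contract-Chain = record
    { ends = ends ∘ punchIn e ; Ps = mergePartition (ends e) ∘ Ps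
    ; Kept = λ i → Kept i × proj₁ (l i e) ≢ proj₂ (l i e)
    ; Kept? = λ i → Kept? i ×-dec ¬? (proj₁ (l i e) ≟ proj₂ (l i e))
    ; finer = λ i j i<j → mergePartition-finer (ends e) (finer i j i<j)
    -- Bases of both levels lose exactly the element `e`, so the strict inequality persists.
    ; larger = λ {i} {j} i<j (q , nl) (q′ , nl′) {B} {B′} bB bB′ →
        s<s⁻¹ (subst₂ _<_ (∣insertAt-true∣ B e) (∣insertAt-true∣ B′ e)
          (larger i<j q q′ (to (Basis-contract (l i) e nl B) bB)
            (to (Basis-contract (l j) e nl′ B′) bB′)))
    ; feasible = λ S → mk⇔
        (λ FS → let i , q , bS = to (feasible (insertAt S e true))
                      (trans (sym (contract-insertAt F e S)) FS)
                    nl = λ loop → loop⇒¬Indep (l i) e loop (e∈insertAt S e) (proj₁ bS)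
                in i , (q , nl) , from (Basis-contract (l i) e nl S) bS)
        (λ (i , (q , nl) , bS) → trans (contract-insertAt F e S)
          (from (feasible (insertAt S e true)) (i , q , to (Basis-contract (l i) e nl S) bS))) }

theorem3p19 : ∀ {n m} (F : Fam n) (G : Fam m) → IsGraphic F → Minor F G → IsGraphic G
theorem3p19 F G graphic here = graphic
-- Each `Minor` constructor carries the flag matroid property of its result, so only the chain of
-- partitions has to be built.
theorem3p19 F _ graphic (del {G = G} minor e flag) =
  Chain⇒IsGraphic flag (delete-Chain e (IsGraphic⇒Chain (theorem3p19 F G graphic minor)))
theorem3p19 F _ graphic (con {G = G} minor e flag) =
  Chain⇒IsGraphic flag (contract-Chain e (IsGraphic⇒Chain (theorem3p19 F G graphic minor)))
theorem3p19 F _ graphic (chp {G = G} minor i flag) =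
  Chain⇒IsGraphic flag (chop-Chain i (IsGraphic⇒Chain (theorem3p19 F G graphic minor)))
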